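{- Let $\lambda>1$. For interval selection with proportional weights and revocable acceptances, Algorithm Revoke-Proportional with parameter $\lambda$ is $\frac{3\lambda}{\lambda-1}$-consistent; that is, for every instance and arrival order, whenever all predictions are accurate (with respect to a fixed optimal solution), $\frac{OPT}{ALG}\le \frac{3\lambda}{\lambda-1}$.
   Context: Interval selection: an instance is a finite nonempty set of intervals $[s_i,f_i)$ on the real line, $s_i<f_i$, arriving one at a time in an arbitrary (adversarial) order. Two intervals conflict if they intersect. Proportional weights means $w([s,f))=f-s$. The goal is to output a set of pairwise disjoint intervals of maximum total weight. $OPT$ denotes the maximum total weight of a set of pairwise disjoint intervals of the instance, and $ALG$ the total weight of the algorithm's final solution. Revocable acceptances: a newly arrived interval may be accepted by discarding all conflicting intervals in the current solution; rejected or discarded intervals can never be used again. Predictions: each interval $I$ arrives together with a bit $Prd(I)\in\{0,1\}$ predicting whether $I$ belongs to a fixed optimal solution $O$; all predictions are accurate if for every $I$, $Prd(I)=1\iff I\in O$. An algorithm is (strictly) $c$-competitive if $OPT/ALG\le c$ for all instances and arrival orders; it is $\gamma$-consistent if it is $\gamma$-competitive whenever all predictions are accurate. Algorithm Revoke-Proportional (parameter $\lambda>1$): start with an empty solution. On the arrival of $I$, let $I_s$ be the set of intervals currently in the solution conflicting with $I$, and $w_c=\sum_{J\in I_s}w(J)$. (1) Main rule: if $w(I)\ge\lambda\cdot w_c$, accept $I$ and discard all intervals of $I_s$. (2) Predictions rule: otherwise, if $Prd(I)=1$, $w(I)\ge w_c$, and no $J\in I_s$ has $Prd(J)=1$, accept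 $I$ and discard all intervals of $I_s$. (3) Otherwise reject $I$. -}

module Defs where

open import Algebra.Bundles using (CommutativeRing)
import Algebra.Definitions as AlgebraDefinitions
import Algebra.Definitions.RawMonoid as RawMonoidDefinitions
open import Data.Bool.Base using (Bool; true; if_then_else_)
import Data.Bool.Properties as Bool
open import Data.Fin.Base using (Fin)
open import Data.Fin.Properties using (any?)
open import Data.Fin.Subset using (Subset; ⊥; ⁅_⁆; _∈_; _∩_; _∪_; _─_)
open import Data.Fin.Subset.Properties using (_∈?_)
open import Data.List.Base using (foldl; allFin)
open import Data.Nat.Base using (ℕ; NonZero)
open import Data.Product.Base using (∃; Σ-syntax; _×_; _,_; proj₁)
open import Data.Sum.Base using (inj₁; inj₂)
open import Data.Vec.Base using (lookup; tabulate)
open import Function.Base using (_∘_)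
open import Function.Bundles using (_⇔_)
open import Function.Definitions using (Injective)
open import Level using (suc; _⊔_)
open import Relation.Binary.Bundles using (DecTotalOrder)
open import Relation.Binary.Core using (Rel)
import Relation.Binary.Properties.DecTotalOrder as DecTotalOrderProperties
open import Relation.Binary.PropositionalEquality.Core using (_≡_; _≢_)
open import Relation.Binary.Structures using (IsDecTotalOrder)
open import Relation.Nullary.Decidable.Core using (Dec; does; yes; no; map′; _×-dec_)
open import Relation.Nullary.Decidable using (¬?)
open import Relation.Nullary.Negation.Core using (¬_)

-- The standard library has no real numbers, so an arbitrary ordered field
-- plays the role of the real line. The decidability of _≤_ is what allows the
-- algorithm below to be a function; classically ℝ is an instance.
record OrderedField c ℓ₁ ℓ₂ : Set (suc (c ⊔ ℓ₁ ⊔ ℓ₂)) where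
  field
    commutativeRing : CommutativeRing c ℓ₁

  open CommutativeRing commutativeRing public
  open AlgebraDefinitions _≈_ using (Invertible)

  infix 4 _≤_
  field
    _≤_             : Rel Carrier ℓ₂
    isDecTotalOrder : IsDecTotalOrder _≈_ _≤_
    0≉1             : ¬ (0# ≈ 1#)
    invertible      : ∀ {x} → ¬ (x ≈ 0#) → Invertible 1# _*_ x
    +-monoʳ-≤       : ∀ z {x y} → x ≤ y → z + x ≤ z + y
    *-nonneg        : ∀ {x y} → 0# ≤ x → 0# ≤ y → 0# ≤ x * y

  decTotalOrder : DecTotalOrder c ℓ₁ ℓ₂
  decTotalOrder = record { isDecTotalOrder = isDecTotalOrder }

  open DecTotalOrder decTotalOrder public
    using (_≟_; _≤?_; total; antisym; ≤-respˡ-≈; ≤-respʳ-≈)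
    renaming (refl to ≤-refl; reflexive to ≤-reflexive; trans to ≤-trans)

  -- Here x < y means x ≤ y × ¬ (x ≈ y).
  open DecTotalOrderProperties decTotalOrder public
    using (_<_; <-respˡ-≈; <-respʳ-≈; <⇒≱; ≰⇒>)

  infix 4 _<?_
  _<?_ : ∀ x y → Dec (x < y)
  x <? y = (x ≤? y) ×-dec ¬? (x ≟ y)

  infixl 7 _/_⟨_⟩
  _/_⟨_⟩ : ∀ (x y : Carrier) → 0# < y → Carrier
  x / y ⟨ _ , 0≉y ⟩ = x * proj₁ (invertible (0≉y ∘ sym))

  x<y⇒0<y-x : ∀ {x y} → x < y → 0# < y - x
  x<y⇒0<y-x {x} {y} (x≤y , x≉y) =
      ≤-respˡ-≈ (-‿inverseˡ x) (≤-respʳ-≈ (+-comm (- x) y) (+-monoʳ-≤ (- x) x≤y))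
    , λ 0≈y-x → x≉y
        (trans (sym (+-identityˡ x))
        (trans (+-congʳ 0≈y-x)
        (trans (+-assoc y (- x) x)
        (trans (+-congˡ (-‿inverseˡ x))
               (+-identityʳ y)))))

module IntervalSelection {c ℓ₁ ℓ₂} (F : OrderedField c ℓ₁ ℓ₂) where

  open OrderedField F
  open RawMonoidDefinitions +-rawMonoid using (sum)

  -- The half-open interval [ start , finish ).
  record Interval : Set (c ⊔ ℓ₁ ⊔ ℓ₂) where
    field
      start        : Carrier
      finish       : Carrier
      start<finish : start < finish

  open Interval public

  infix 4 _≈ᴵ_ _∈ᴵ_

  _≈ᴵ_ : Rel Interval ℓ₁
  I ≈ᴵ J = start I ≈ start J × finish I ≈ finish J

  _∈ᴵ_ : Carrier → Interval → Set (ℓ₁ ⊔ ℓ₂)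
  x ∈ᴵ I = start I ≤ x × x < finish I

  Conflict : Rel Interval (c ⊔ ℓ₁ ⊔ ℓ₂)
  Conflict I J = ∃ λ x → x ∈ᴵ I × x ∈ᴵ J

  conflict? : ∀ I J → Dec (Conflict I J)
  conflict? I J = map′ to from ((start I <? finish J) ×-dec (start J <? finish I))
    where
    to : start I < finish J × start J < finish I → Conflict I J
    to (sI<fJ , sJ<fI) with total (start I) (start J)
    ... | inj₁ sI≤sJ = start J , (sI≤sJ , sJ<fI) , (≤-refl , start<finish J)
    ... | inj₂ sJ≤sI = start I , (≤-refl , start<finish I) , (sJ≤sI , sI<fJ)

    ≤-<-trans : ∀ {x y z} → x ≤ y → y < z → x < z
    ≤-<-trans x≤y (y≤z , y≉z) =
        ≤-trans x≤y y≤z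
      , λ x≈z → y≉z (antisym y≤z (≤-respˡ-≈ x≈z x≤y))

    from : Conflict I J → start I < finish J × start J < finish I
    from (x , (sI≤x , x<fI) , (sJ≤x , x<fJ)) = ≤-<-trans sI≤x x<fJ , ≤-<-trans sJ≤x x<fI

  weight : Interval → Carrier
  weight I = finish I - start I

  -- An instance together with its arrival order: interval i is the i-th to
  -- arrive. Sets of intervals of the instance are subsets of the index set.
  Arrivals : ℕ → Set (c ⊔ ℓ₁ ⊔ ℓ₂)
  Arrivals n = Fin n → Interval

  Predictions : ℕ → Set
  Predictions n = Fin n → Bool

  -- The instance is a set, so no interval arrives twice.
  Distinct : ∀ {n} → Arrivals n → Set ℓ₁
  Distinct = Injective _≡_ _≈ᴵ_

  totalWeight : ∀ {n} → Arrivals n → Subset n → Carrier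
  totalWeight I S = sum λ i → if lookup S i then weight (I i) else 0#

  PairwiseDisjoint : ∀ {n} → Arrivals n → Subset n → Set (c ⊔ ℓ₁ ⊔ ℓ₂)
  PairwiseDisjoint I S = ∀ {i j} → i ∈ S → j ∈ S → i ≢ j → ¬ Conflict (I i) (I j)

  IsOPT : ∀ {n} → Arrivals n → Carrier → Set (c ⊔ ℓ₁ ⊔ ℓ₂)
  IsOPT I opt =
      (∃ λ S → PairwiseDisjoint I S × totalWeight I S ≈ opt)
    × (∀ S → PairwiseDisjoint I S → totalWeight I S ≤ opt)

  OptimalSolution : ∀ {n} → Arrivals n → Subset n → Set (c ⊔ ℓ₁ ⊔ ℓ₂)
  OptimalSolution I O = PairwiseDisjoint I O × IsOPT I (totalWeight I O)

  Accurate : ∀ {n} → Predictions n → Subset n → Set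
  Accurate Prd O = ∀ i → Prd i ≡ true ⇔ i ∈ O

  Algorithm : Set (c ⊔ ℓ₁ ⊔ ℓ₂)
  Algorithm = ∀ {n} → Arrivals n → Predictions n → Subset n

  -- The first component of the conclusion makes the ratio OPT / ALG meaningful.
  Consistent : Carrier → Algorithm → Set (c ⊔ ℓ₁ ⊔ ℓ₂)
  Consistent γ A =
    ∀ {n} .{{_ : NonZero n}} (I : Arrivals n) → Distinct I →
    ∀ (Prd : Predictions n) (O : Subset n) → OptimalSolution I O → Accurate Prd O →
    ∀ opt → IsOPT I opt →
    Σ[ 0<alg ∈ 0# < totalWeight I (A I Prd) ]
      opt / totalWeight I (A I Prd) ⟨ 0<alg ⟩ ≤ γ

  module RevokeProportional (ƛ : Carrier) {n} (I : Arrivals n) (Prd : Predictions n) where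

    conflicting : Subset n → Fin n → Subset n
    conflicting S i = S ∩ tabulate (λ j → does (conflict? (I i) (I j)))

    conflictWeight : Subset n → Fin n → Carrier
    conflictWeight S i = totalWeight I (conflicting S i)

    MainRule : Subset n → Fin n → Set ℓ₂
    MainRule S i = ƛ * conflictWeight S i ≤ weight (I i)

    mainRule? : ∀ S i → Dec (MainRule S i)
    mainRule? S i = ƛ * conflictWeight S i ≤? weight (I i)

    PredictionsRule : Subset n → Fin n → Set ℓ₂
    PredictionsRule S i =
        Prd i ≡ true
      × conflictWeight S i ≤ weight (I i)
      × ¬ (∃ λ j → j ∈ conflicting S i × Prd j ≡ true)

    predictionsRule? : ∀ S i → Dec (PredictionsRule S i)
    predictionsRule? S i =
      (Prd i Bool.≟ true)
      ×-dec (conflictWeight S i ≤? weight (I i))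
      ×-dec ¬? (any? λ j → (j ∈? conflicting S i) ×-dec (Prd j Bool.≟ true))

    accept : Subset n → Fin n → Subset n
    accept S i = (S ─ conflicting S i) ∪ ⁅ i ⁆

    step : Subset n → Fin n → Subset n
    step S i with mainRule? S i | predictionsRule? S i
    ... | yes _ | _     = accept S i
    ... | no  _ | yes _ = accept S i
    ... | no  _ | no  _ = S

    solution : Subset n
    solution = foldl step ⊥ (allFin n)

  revokeProportional : Carrier → Algorithm
  revokeProportional ƛ I Prd = RevokeProportional.solution ƛ I Prd

{-# OPTIONS --safe #-}
module Submission where

-- Let w be the weight, O the optimal solution and γ = 3 ƛ / (ƛ - 1). While the
-- current solution is S, let an interval of O that has arrived count with its
-- weight, and one that has not count with the smaller of its weight and the
-- weight of the intervals of S in conflict with it. The total never exceeds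
-- γ w(S). Rejecting i adds nothing to it, since an interval of O is rejected
-- only if it is outweighed by its conflicts, of weight c say. Accepting i
-- raises γ w(S) by γ (w(i) - c), which under the predictions rule pays for the
-- increase w(i) - c in the count of i, and under the main rule is at least
-- 3 w(i). The latter suffices because the intervals of O in conflict with i,
-- each counted with at most w(i), have total weight at most 3 w(i): they occupy
-- as much disjoint space in i stretched by w(i) on both sides.

import Algebra.Construct.NaturalChoice.Max as Max
import Algebra.Construct.NaturalChoice.Min as Min
import Algebra.Properties.CommutativeMonoid.Sum as Sums
import Algebra.Properties.Ring as RingProperties
open import Data.Bool.Base using (Bool; true; false; not; _∧_; _∨_; if_then_else_)
open import Data.Fin.Base using (Fin; zero; suc)
import Data.Fin.Properties as Fin
open import Data.Fin.Subset using (Subset; ⊥; ⁅_⁆; _∈_; _∉_; _∩_; _∪_; _─_)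
open import Data.Fin.Subset.Properties
  using (_∈?_; ∉⊥; x∈⁅x⁆; x∈⁅y⁆⇒x≡y; x∈p∩q⁻; x∈p∪q⁻; p─q⊆p; ∩-zeroˡ)
open import Data.List.Base using (List; []; _∷_; foldl; allFin)
import Data.List.Membership.DecPropositional as DecMembership
open import Data.List.Membership.Propositional.Properties using (∈-allFin)
open import Data.List.Relation.Unary.All using (_∷_)
open import Data.List.Relation.Unary.All.Properties using (All¬⇒¬Any)
open import Data.List.Relation.Unary.AllPairs using ([]; _∷_)
open import Data.List.Relation.Unary.Any using (here; there)
open import Data.List.Relation.Unary.Unique.Propositional using (Unique)
open import Data.List.Relation.Unary.Unique.Propositional.Properties using (allFin⁺)
open import Data.Nat.Base using (zero; suc; NonZero)
open import Data.Product.Base using (∃; _×_; _,_; proj₁; proj₂)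
open import Data.Sum.Base using (_⊎_; inj₁; inj₂)
import Data.Sum.Base as Sum
open import Data.Vec.Base using (_∷_; lookup; tabulate)
open import Data.Vec.Properties using (lookup-zipWith; lookup∘tabulate; []=⇒lookup; lookup⇒[]=)
open import Function.Base using (_∘_)
open import Function.Bundles using (Equivalence)
open import Relation.Binary.Bundles using (DecTotalOrder)
open import Relation.Binary.PropositionalEquality.Core using (_≡_; _≢_)
import Relation.Binary.PropositionalEquality.Core as ≡
import Relation.Binary.Reasoning.PartialOrder as PosetReasoning
open import Relation.Nullary.Decidable using (Dec; does; yes; no; dec-true; dec-false)
open import Relation.Nullary.Negation using (¬_; contradiction)

open import Defs

-- Membership bits of subset operations.

lookup-∩ : ∀ {n} (p q : Subset n) i → lookup (p ∩ q) i ≡ lookup p i ∧ lookup q i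
lookup-∩ p q i = lookup-zipWith _∧_ i p q

lookup-∪ : ∀ {n} (p q : Subset n) i → lookup (p ∪ q) i ≡ lookup p i ∨ lookup q i
lookup-∪ p q i = lookup-zipWith _∨_ i p q

lookup-─ : ∀ {n} (p q : Subset n) i → lookup (p ─ q) i ≡ lookup p i ∧ not (lookup q i)
lookup-─ (true  ∷ p) (true  ∷ q) zero    = ≡.refl
lookup-─ (true  ∷ p) (false ∷ q) zero    = ≡.refl
lookup-─ (false ∷ p) (true  ∷ q) zero    = ≡.refl
lookup-─ (false ∷ p) (false ∷ q) zero    = ≡.refl
lookup-─ (_     ∷ p) (_     ∷ q) (suc i) = lookup-─ p q i

-- Arithmetic in an ordered field.

module OrderedFieldProperties {c ℓ₁ ℓ₂} (F : OrderedField c ℓ₁ ℓ₂) where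

  open OrderedField F hiding (zero)
  open RingProperties ring using (-‿distribˡ-*; -‿involutive)
  open DecTotalOrder decTotalOrder using (poset; totalOrder)
  open PosetReasoning poset
  open Min totalOrder public
  open Max totalOrder public
  open Sums +-commutativeMonoid using (sum; sum-cong-≋; ∑-distrib-+; sum-replicate-zero)

  3# : Carrier
  3# = 1# + 1# + 1#

  +-monoˡ-≤ : ∀ z {x y} → x ≤ y → x + z ≤ y + z
  +-monoˡ-≤ z {x} {y} x≤y = begin
    x + z ≈⟨ +-comm x z ⟩
    z + x ≤⟨ +-monoʳ-≤ z x≤y ⟩
    z + y ≈⟨ +-comm z y ⟩
    y + z ∎

  +-mono-≤ : ∀ {x y u v} → x ≤ y → u ≤ v → x + u ≤ y + v
  +-mono-≤ {y = y} {u = u} x≤y u≤v = ≤-trans (+-monoˡ-≤ u x≤y) (+-monoʳ-≤ y u≤v)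

  +-nonneg : ∀ {x y} → 0# ≤ x → 0# ≤ y → 0# ≤ x + y
  +-nonneg 0≤x 0≤y = ≤-respˡ-≈ (+-identityˡ 0#) (+-mono-≤ 0≤x 0≤y)

  x≤x+y : ∀ x {y} → 0# ≤ y → x ≤ x + y
  x≤x+y x 0≤y = ≤-respˡ-≈ (+-identityʳ x) (+-monoʳ-≤ x 0≤y)

  [x-y]+y≈x : ∀ x y → (x - y) + y ≈ x
  [x-y]+y≈x x y = trans (+-assoc x (- y) y) (trans (+-congˡ (-‿inverseˡ y)) (+-identityʳ x))

  [x-y]+[y-z]≈x-z : ∀ x y z → (x - y) + (y - z) ≈ x - z
  [x-y]+[y-z]≈x-z x y z = trans (sym (+-assoc (x - y) y (- z))) (+-congʳ ([x-y]+y≈x x y))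

  [x+y]-y≈x : ∀ x y → (x + y) - y ≈ x
  [x+y]-y≈x x y = trans (+-assoc x y (- y)) (trans (+-congˡ (-‿inverseʳ y)) (+-identityʳ x))

  x+[y-x]≈y : ∀ x y → x + (y - x) ≈ y
  x+[y-x]≈y x y = trans (+-comm x (y - x)) ([x-y]+y≈x y x)

  x-[x-y]≈y : ∀ x y → x - (x - y) ≈ y
  x-[x-y]≈y x y = trans (+-congʳ (trans (sym ([x-y]+y≈x x y)) (+-comm (x - y) y)))
    ([x+y]-y≈x y (x - y))

  x-y≤x : ∀ x {y} → 0# ≤ y → x - y ≤ x
  x-y≤x x {y} 0≤y = ≤-respʳ-≈ ([x-y]+y≈x x y) (x≤x+y (x - y) 0≤y)

  +-cancelʳ-≤ : ∀ z {x y} → x + z ≤ y + z → x ≤ y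
  +-cancelʳ-≤ z {x} {y} x+z≤y+z = begin
    x             ≈⟨ [x+y]-y≈x x z ⟨
    (x + z) - z   ≤⟨ +-monoˡ-≤ (- z) x+z≤y+z ⟩
    (y + z) - z   ≈⟨ [x+y]-y≈x y z ⟩
    y             ∎

  x≤y⇒0≤y-x : ∀ {x y} → x ≤ y → 0# ≤ y - x
  x≤y⇒0≤y-x {x} x≤y = ≤-respˡ-≈ (-‿inverseʳ x) (+-monoˡ-≤ (- x) x≤y)

  -‿antimono-≤ : ∀ {x y} → x ≤ y → - y ≤ - x
  -‿antimono-≤ {x} {y} x≤y = +-cancelʳ-≤ y (begin
    - y + y     ≈⟨ -‿inverseˡ y ⟩
    0#          ≤⟨ x≤y⇒0≤y-x x≤y ⟩
    y - x       ≈⟨ +-comm y (- x) ⟩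
    - x + y     ∎)

  minus-mono-≤ : ∀ {x y u v} → x ≤ y → v ≤ u → x - u ≤ y - v
  minus-mono-≤ x≤y v≤u = +-mono-≤ x≤y (-‿antimono-≤ v≤u)

  *-monoˡ-≤-nonneg : ∀ {z x y} → 0# ≤ z → x ≤ y → z * x ≤ z * y
  *-monoˡ-≤-nonneg {z} {x} {y} 0≤z x≤y = begin
    z * x                     ≤⟨ x≤x+y (z * x) (*-nonneg 0≤z (x≤y⇒0≤y-x x≤y)) ⟩
    z * x + z * (y - x)       ≈⟨ distribˡ z x (y - x) ⟨
    z * (x + (y - x))         ≈⟨ *-congˡ (x+[y-x]≈y x y) ⟩
    z * y                     ∎

  -- If `1# ≤ 0#`, then `- 1#` is nonnegative, and so is its square, which is `1#`.
  0≤1 : 0# ≤ 1#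
  0≤1 with total 0# 1#
  ... | inj₁ 0≤1′ = 0≤1′
  ... | inj₂ 1≤0 = begin
    0#              ≤⟨ *-nonneg 0≤-1 0≤-1 ⟩
    - 1# * - 1#     ≈⟨ -‿distribˡ-* 1# (- 1#) ⟨
    - (1# * - 1#)   ≈⟨ -‿cong (*-identityˡ (- 1#)) ⟩
    - - 1#          ≈⟨ -‿involutive 1# ⟩
    1#              ∎
    where
    0≤-1 : 0# ≤ - 1#
    0≤-1 = ≤-respʳ-≈ (+-identityˡ (- 1#)) (x≤y⇒0≤y-x 1≤0)

  0≤3 : 0# ≤ 3#
  0≤3 = +-nonneg (+-nonneg 0≤1 0≤1) 0≤1

  3x≈x+[x+x] : ∀ x → 3# * x ≈ x + (x + x)
  3x≈x+[x+x] x = begin-equality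
    3# * x                        ≈⟨ distribʳ x (1# + 1#) 1# ⟩
    (1# + 1#) * x + 1# * x        ≈⟨ +-congʳ (distribʳ x 1# 1#) ⟩
    (1# * x + 1# * x) + 1# * x    ≈⟨ +-assoc (1# * x) (1# * x) (1# * x) ⟩
    1# * x + (1# * x + 1# * x)    ≈⟨ +-cong 1x≈x (+-cong 1x≈x 1x≈x) ⟩
    x + (x + x)                   ∎
    where
    1x≈x : 1# * x ≈ x
    1x≈x = *-identityˡ x

  x≤3x : ∀ {x} → 0# ≤ x → x ≤ 3# * x
  x≤3x {x} 0≤x = ≤-respʳ-≈ (sym (3x≈x+[x+x] x)) (x≤x+y x (+-nonneg 0≤x 0≤x))

  inverse-nonneg : ∀ {x y} → 0# ≤ x → x * y ≈ 1# → 0# ≤ y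
  inverse-nonneg {x} {y} 0≤x xy≈1 with total 0# y
  ... | inj₁ 0≤y = 0≤y
  ... | inj₂ y≤0 = contradiction (antisym 0≤1 1≤0) 0≉1
    where
    1≤0 : 1# ≤ 0#
    1≤0 = ≤-respˡ-≈ xy≈1 (≤-respʳ-≈ (zeroʳ x) (*-monoˡ-≤-nonneg 0≤x y≤0))

  <-≤-trans : ∀ {x y z} → x < y → y ≤ z → x < z
  <-≤-trans (x≤y , x≉y) y≤z = ≤-trans x≤y y≤z , λ x≈z → x≉y (antisym x≤y (≤-respʳ-≈ (sym x≈z) y≤z))

  /-≤ : ∀ {x y z} (0<y : 0# < y) → x ≤ z * y → x / y ⟨ 0<y ⟩ ≤ z
  /-≤ {x} {y} {z} (0≤y , 0≉y) x≤zy = begin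
    x * v          ≈⟨ *-comm x v ⟩
    v * x          ≤⟨ *-monoˡ-≤-nonneg (inverse-nonneg 0≤y yv≈1) x≤zy ⟩
    v * (z * y)    ≈⟨ *-comm v (z * y) ⟩
    z * y * v      ≈⟨ *-assoc z y v ⟩
    z * (y * v)    ≈⟨ *-congˡ yv≈1 ⟩
    z * 1#         ≈⟨ *-identityʳ z ⟩
    z              ∎
    where
    v = proj₁ (invertible (0≉y ∘ sym))
    yv≈1 : y * v ≈ 1#
    yv≈1 = proj₂ (proj₂ (invertible (0≉y ∘ sym)))

  -- If `z` or `w` reaches `x`, its truncation alone is `x`; otherwise neither is truncated and
  -- `y ≤ z + w` applies. It splits a capped conflict weight when one interval joins the solution.
  ⊓-subadditive : ∀ {x y z w} → 0# ≤ x → 0# ≤ z → 0# ≤ w → y ≤ z + w →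
                  x ⊓ y ≤ x ⊓ z + x ⊓ w
  ⊓-subadditive {x} {y} {z} {w} 0≤x 0≤z 0≤w y≤z+w = bound (total x z) (total x w)
    where
    bound : x ≤ z ⊎ z ≤ x → x ≤ w ⊎ w ≤ x → x ⊓ y ≤ x ⊓ z + x ⊓ w
    bound (inj₁ x≤z) _ = begin
      x ⊓ y            ≤⟨ x⊓y≤x x y ⟩
      x                ≈⟨ x≤y⇒x⊓y≈x x≤z ⟨
      x ⊓ z            ≤⟨ x≤x+y (x ⊓ z) (⊓-glb 0≤x 0≤w) ⟩
      x ⊓ z + x ⊓ w    ∎
    bound (inj₂ z≤x) (inj₁ x≤w) = begin
      x ⊓ y            ≤⟨ x⊓y≤x x y ⟩
      x                ≈⟨ x≤y⇒x⊓y≈x x≤w ⟨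
      x ⊓ w            ≤⟨ x≤x+y (x ⊓ w) (⊓-glb 0≤x 0≤z) ⟩
      x ⊓ w + x ⊓ z    ≈⟨ +-comm (x ⊓ w) (x ⊓ z) ⟩
      x ⊓ z + x ⊓ w    ∎
    bound (inj₂ z≤x) (inj₂ w≤x) = begin
      x ⊓ y            ≤⟨ x⊓y≤y x y ⟩
      y                ≤⟨ y≤z+w ⟩
      z + w            ≈⟨ +-cong (x≤y⇒y⊓x≈x z≤x) (x≤y⇒y⊓x≈x w≤x) ⟨
      x ⊓ z + x ⊓ w    ∎

  -- Sums, packing and clamping.

  if-nonneg : ∀ b {x} → 0# ≤ x → 0# ≤ (if b then x else 0#)
  if-nonneg true  0≤x = 0≤x
  if-nonneg false 0≤x = ≤-refl

  if-does-≤ : ∀ {p} {P : Set p} (P? : Dec P) {x y} → (P → x ≤ y) → 0# ≤ y →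
              (if does P? then x else 0#) ≤ y
  if-does-≤ (yes p) x≤y 0≤y = x≤y p
  if-does-≤ (no _)  x≤y 0≤y = 0≤y

  sum-mono-≤ : ∀ {n} {f g : Fin n → Carrier} → (∀ i → f i ≤ g i) → sum f ≤ sum g
  sum-mono-≤ {zero}  f≤g = ≤-refl
  sum-mono-≤ {suc n} f≤g = +-mono-≤ (f≤g zero) (sum-mono-≤ (f≤g ∘ suc))

  -- The intervals lying on either side of the first one are separated by
  -- truncating all of them at its two endpoints.
  packing : ∀ {n} (s f : Fin n → Carrier) {a b} → a ≤ b →
            (∀ i → a ≤ s i) → (∀ i → s i ≤ f i) → (∀ i → f i ≤ b) →
            (∀ {i j} → i ≢ j → f i ≤ s j ⊎ f j ≤ s i) →
            sum (λ i → f i - s i) ≤ b - a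
  packing {zero}  s f a≤b a≤s s≤f f≤b separated = x≤y⇒0≤y-x a≤b
  packing {suc n} s f {a} {b} a≤b a≤s s≤f f≤b separated = begin
    (f₀ - s₀) + sum (λ i → f (suc i) - s (suc i))
      ≈⟨ +-congˡ (trans (sum-cong-≋ split) (∑-distrib-+ left right)) ⟩
    (f₀ - s₀) + (sum left + sum right)
      ≤⟨ +-monoʳ-≤ (f₀ - s₀) (+-mono-≤ left≤ right≤) ⟩
    (f₀ - s₀) + ((s₀ - a) + (b - f₀))
      ≈⟨ +-congˡ (+-comm (s₀ - a) (b - f₀)) ⟩
    (f₀ - s₀) + ((b - f₀) + (s₀ - a))
      ≈⟨ +-assoc (f₀ - s₀) (b - f₀) (s₀ - a) ⟨
    ((f₀ - s₀) + (b - f₀)) + (s₀ - a)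
      ≈⟨ +-congʳ (trans (+-comm (f₀ - s₀) (b - f₀)) ([x-y]+[y-z]≈x-z b f₀ s₀)) ⟩
    (b - s₀) + (s₀ - a)
      ≈⟨ [x-y]+[y-z]≈x-z b s₀ a ⟩
    b - a
      ∎
    where
    s₀ = s zero
    f₀ = f zero
    left right : Fin n → Carrier
    left  i = f (suc i) ⊓ s₀ - s (suc i) ⊓ s₀
    right i = (f (suc i) ⊔ f₀) - (s (suc i) ⊔ f₀)

    separated-suc : ∀ {i j} → i ≢ j → f (suc i) ≤ s (suc j) ⊎ f (suc j) ≤ s (suc i)
    separated-suc i≢j = separated (i≢j ∘ Fin.suc-injective)

    split : ∀ i → f (suc i) - s (suc i) ≈ left i + right i
    split i with separated {suc i} {zero} (λ ())
    ... | inj₁ f≤s₀ = sym (trans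
      (+-cong (+-cong (x≤y⇒x⊓y≈x f≤s₀) (-‿cong (x≤y⇒x⊓y≈x (≤-trans (s≤f (suc i)) f≤s₀))))
              (trans (+-cong (x≤y⇒x⊔y≈y f≤f₀) (-‿cong (x≤y⇒x⊔y≈y (≤-trans (s≤f (suc i)) f≤f₀))))
                     (-‿inverseʳ f₀)))
      (+-identityʳ _))
      where
      f≤f₀ = ≤-trans f≤s₀ (s≤f zero)
    ... | inj₂ f₀≤s = sym (trans
      (+-cong (trans (+-cong (x≤y⇒y⊓x≈x (≤-trans s₀≤s (s≤f (suc i)))) (-‿cong (x≤y⇒y⊓x≈x s₀≤s)))
                     (-‿inverseʳ s₀))
              (+-cong (x≤y⇒y⊔x≈y (≤-trans f₀≤s (s≤f (suc i)))) (-‿cong (x≤y⇒y⊔x≈y f₀≤s))))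
      (+-identityˡ _))
      where
      s₀≤s = ≤-trans (s≤f zero) f₀≤s

    -- Truncated segments can be empty, which is why `packing` asks only for `s i ≤ f i`; monotone
    -- truncation keeps them separated.
    left≤ : sum left ≤ s₀ - a
    left≤ = packing (λ i → s (suc i) ⊓ s₀) (λ i → f (suc i) ⊓ s₀) (a≤s zero)
      (λ i → ⊓-glb (a≤s (suc i)) (a≤s zero))
      (λ i → ⊓-monoˡ-≤ s₀ (s≤f (suc i)))
      (λ i → x⊓y≤y (f (suc i)) s₀)
      (Sum.map (⊓-monoˡ-≤ s₀) (⊓-monoˡ-≤ s₀) ∘ separated-suc)

    right≤ : sum right ≤ b - f₀
    right≤ = packing (λ i → s (suc i) ⊔ f₀) (λ i → f (suc i) ⊔ f₀) (f≤b zero)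
      (λ i → x≤y⊔x (s (suc i)) f₀)
      (λ i → ⊔-monoˡ-≤ f₀ (s≤f (suc i)))
      (λ i → ⊔-lub (f≤b (suc i)) (f≤b zero))
      (Sum.map (⊔-monoˡ-≤ f₀) (⊔-monoˡ-≤ f₀) ∘ separated-suc)

  module Clamp {a b} (a≤b : a ≤ b) where

    -- Nearest point of `[a, b]`. Being monotone, it keeps disjoint segments separated while moving
    -- them into the room available to `packing`.
    clamp : Carrier → Carrier
    clamp x = a ⊔ (x ⊓ b)

    a≤clamp : ∀ x → a ≤ clamp x
    a≤clamp x = x≤x⊔y a (x ⊓ b)

    clamp≤b : ∀ x → clamp x ≤ b
    clamp≤b x = ⊔-lub a≤b (x⊓y≤y x b)

    clamp-mono-≤ : ∀ {x y} → x ≤ y → clamp x ≤ clamp y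
    clamp-mono-≤ x≤y = ⊔-monoʳ-≤ a (⊓-monoˡ-≤ b x≤y)

    ≤-clamp : ∀ {x y} → y ≤ x → y ≤ b → y ≤ clamp x
    ≤-clamp {x} y≤x y≤b = ≤-trans (⊓-glb y≤x y≤b) (x≤y⊔x a (x ⊓ b))

    clamp-≤ : ∀ {x y} → x ≤ y → a ≤ y → clamp x ≤ y
    clamp-≤ {x} x≤y a≤y = ⊔-lub a≤y (x≤y⇒x⊓z≤y b x≤y)

  -- If [s, f] meets [p, q], then either it lies within [p - w, q + w], or it
  -- covers all of [p - w, p] or all of [q, q + w].
  ⊓-clamp-≤ : ∀ {s f p q w} (p-w≤q+w : p - w ≤ q + w) (let open Clamp p-w≤q+w) →
            0# ≤ w → p ≤ q → s ≤ q → p ≤ f → (f - s) ⊓ w ≤ clamp f - clamp s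
  ⊓-clamp-≤ {s} {f} {p} {q} {w} p-w≤q+w 0≤w p≤q s≤q p≤f = bound (total (p - w) s) (total f (q + w))
    where
    open Clamp p-w≤q+w
    q≤q+w = x≤x+y q 0≤w

    bound : p - w ≤ s ⊎ s ≤ p - w → f ≤ q + w ⊎ q + w ≤ f → (f - s) ⊓ w ≤ clamp f - clamp s
    bound (inj₁ p-w≤s) (inj₁ f≤q+w) = begin
      (f - s) ⊓ w           ≤⟨ x⊓y≤x (f - s) w ⟩
      f - s                 ≤⟨ minus-mono-≤ (≤-clamp ≤-refl f≤q+w) (clamp-≤ ≤-refl p-w≤s) ⟩
      clamp f - clamp s     ∎
    bound (inj₁ p-w≤s) (inj₂ q+w≤f) = begin
      (f - s) ⊓ w           ≤⟨ x⊓y≤y (f - s) w ⟩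
      w                     ≈⟨ [x+y]-y≈x w q ⟨
      (w + q) - q           ≈⟨ +-congʳ (+-comm w q) ⟩
      (q + w) - q           ≤⟨ minus-mono-≤ (≤-clamp q+w≤f ≤-refl)
                                 (clamp-≤ s≤q (≤-trans (x-y≤x p 0≤w) p≤q)) ⟩
      clamp f - clamp s     ∎
    bound (inj₂ s≤p-w) _ = begin
      (f - s) ⊓ w           ≤⟨ x⊓y≤y (f - s) w ⟩
      w                     ≈⟨ x-[x-y]≈y p w ⟨
      p - (p - w)           ≤⟨ minus-mono-≤ (≤-clamp p≤f (≤-trans p≤q q≤q+w))
                                 (clamp-≤ s≤p-w ≤-refl) ⟩
      clamp f - clamp s     ∎

  -- Sums over subsets.

  module _ {n} (S : Subset n) where

    -- `totalWeight I S` unfolds to `sumOver S (weight ∘ I)`, so what is proved here applies to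
    -- weights as well as to credits and increments.
    sumOver : (Fin n → Carrier) → Carrier
    sumOver f = sum λ i → if lookup S i then f i else 0#

    sumOver-mono-≤ : ∀ {f g} → (∀ {i} → i ∈ S → f i ≤ g i) → sumOver f ≤ sumOver g
    sumOver-mono-≤ {f} {g} f≤g = sum-mono-≤ pointwise
      where
      pointwise : ∀ i → (if lookup S i then f i else 0#) ≤ (if lookup S i then g i else 0#)
      pointwise i with lookup S i in i∈S
      ... | true  = f≤g (lookup⇒[]= i S i∈S)
      ... | false = ≤-refl

    sumOver-distrib-+ : ∀ f g → sumOver (λ i → f i + g i) ≈ sumOver f + sumOver g
    sumOver-distrib-+ f g = trans (sum-cong-≋ pointwise) (∑-distrib-+ {n} _ _)
      where
      pointwise : ∀ i → (if lookup S i then f i + g i else 0#) ≈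
                        (if lookup S i then f i else 0#) + (if lookup S i then g i else 0#)
      pointwise i with lookup S i
      ... | true  = refl
      ... | false = sym (+-identityˡ 0#)

    sumOver≤sum : ∀ {f} → (∀ i → 0# ≤ f i) → sumOver f ≤ sum f
    sumOver≤sum {f} 0≤f = sum-mono-≤ pointwise
      where
      pointwise : ∀ i → (if lookup S i then f i else 0#) ≤ f i
      pointwise i with lookup S i
      ... | true  = ≤-refl
      ... | false = 0≤f i

    sumOver-nonneg : ∀ {f} → (∀ i → 0# ≤ f i) → 0# ≤ sumOver f
    sumOver-nonneg {f} 0≤f = begin
      0#                    ≈⟨ sum-replicate-zero n ⟨
      sum {n} (λ _ → 0#)    ≤⟨ sum-mono-≤ (λ i → if-nonneg (lookup S i) (0≤f i)) ⟩
      sumOver f             ∎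

  sumOver-⊥ : ∀ {n} (f : Fin n → Carrier) → sumOver ⊥ f ≈ 0#
  sumOver-⊥ {zero}  f = refl
  sumOver-⊥ {suc n} f = trans (+-identityˡ _) (sumOver-⊥ (f ∘ suc))

  sumOver-⁅⁆ : ∀ {n} (i : Fin n) f → sumOver ⁅ i ⁆ f ≈ f i
  sumOver-⁅⁆ zero    f = trans (+-congˡ (sumOver-⊥ (f ∘ suc))) (+-identityʳ (f zero))
  sumOver-⁅⁆ (suc i) f = trans (+-identityˡ _) (sumOver-⁅⁆ i (f ∘ suc))

-- Conflicts and shared weight.

module ScheduleProperties {c ℓ₁ ℓ₂} (F : OrderedField c ℓ₁ ℓ₂) where

  open OrderedField F hiding (zero)
  open IntervalSelection F
  open OrderedFieldProperties F
  open PosetReasoning (DecTotalOrder.poset decTotalOrder) hiding (start)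
  open Sums +-commutativeMonoid using (sum)

  weight-nonneg : ∀ A → 0# ≤ weight A
  weight-nonneg A = x≤y⇒0≤y-x (proj₁ (start<finish A))

  conflict⇒start≤finish : ∀ A B → Conflict A B → start A ≤ finish B × start B ≤ finish A
  conflict⇒start≤finish A B (x , (sA≤x , x<fA) , (sB≤x , x<fB)) =
    ≤-trans sA≤x (proj₁ x<fB) , ≤-trans sB≤x (proj₁ x<fA)

  -- If neither interval ends before the other begins, the later of the two starts belongs to both.
  ¬conflict⇒separated : ∀ A B → ¬ Conflict A B → finish A ≤ start B ⊎ finish B ≤ start A
  ¬conflict⇒separated A B ¬conflict with finish A ≤? start B | finish B ≤? start A
  ... | yes fA≤sB | _         = inj₁ fA≤sB
  ... | no  _     | yes fB≤sA = inj₂ fB≤sA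
  ... | no  fA≰sB | no  fB≰sA = contradiction meet ¬conflict
    where
    meet : Conflict A B
    meet with total (start A) (start B)
    ... | inj₁ sA≤sB = start B , (sA≤sB , ≰⇒> fA≰sB) , (≤-refl , start<finish B)
    ... | inj₂ sB≤sA = start A , (≤-refl , start<finish A) , (sB≤sA , ≰⇒> fB≰sA)

  module _ {n} (I : Arrivals n) where

    -- Bounds how much accepting `i` can raise the count of `j`: the conflict weight of `j` grows
    -- only if the two meet, by at most `weight (I i)`, and the count is capped by `weight (I j)`.
    sharedWeight : Fin n → Fin n → Carrier
    sharedWeight i j = if does (conflict? (I j) (I i)) then weight (I j) ⊓ weight (I i) else 0#

    sharedWeight-nonneg : ∀ i j → 0# ≤ sharedWeight i j
    sharedWeight-nonneg i j with does (conflict? (I j) (I i))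
    ... | true  = ⊓-glb (weight-nonneg (I j)) (weight-nonneg (I i))
    ... | false = ≤-refl

    sharedWeight-disjoint : ∀ {i j} → ¬ Conflict (I j) (I i) → sharedWeight i j ≡ 0#
    sharedWeight-disjoint {i} {j} ¬conflict =
      ≡.cong (λ b → if b then weight (I j) ⊓ weight (I i) else 0#)
             (dec-false (conflict? (I j) (I i)) ¬conflict)

    -- Stretch I i by its own weight on both sides: each disjoint interval
    -- occupies at least its shared weight in the resulting space.
    sharedWeight-total : ∀ {O} → PairwiseDisjoint I O → ∀ i →
                         sumOver O (sharedWeight i) ≤ 3# * weight (I i)
    sharedWeight-total {O} disjoint i = begin
      sumOver O (sharedWeight i)     ≤⟨ sum-mono-≤ pointwise ⟩
      sum (λ j → f j - s j)          ≤⟨ packing s f a≤b a≤s s≤f f≤b separated ⟩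
      b - a                          ≈⟨ [x-y]+[y-z]≈x-z b q a ⟨
      (b - q) + (q - a)              ≈⟨ +-congˡ ([x-y]+[y-z]≈x-z q p a) ⟨
      (b - q) + (w + (p - a))        ≈⟨ +-cong (trans (+-congʳ (+-comm q w)) ([x+y]-y≈x w q))
                                               (+-congˡ (x-[x-y]≈y p w)) ⟩
      w + (w + w)                    ≈⟨ 3x≈x+[x+x] w ⟨
      3# * w                         ∎
      where
      p = start (I i)
      q = finish (I i)
      w = weight (I i)
      a = p - w
      b = q + w
      0≤w = weight-nonneg (I i)
      p≤q = proj₁ (start<finish (I i))

      a≤b : a ≤ b
      a≤b = ≤-trans (x-y≤x p 0≤w) (≤-trans p≤q (x≤x+y q 0≤w))

      open Clamp a≤b

      s f : Fin n → Carrier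
      -- An interval outside `O` becomes the empty segment at `a`, which is separated from every
      -- other segment since all of them start at or after `a`.
      s j = if lookup O j then clamp (start (I j)) else a
      f j = if lookup O j then clamp (finish (I j)) else a

      a≤s : ∀ j → a ≤ s j
      a≤s j with lookup O j
      ... | true  = a≤clamp _
      ... | false = ≤-refl

      s≤f : ∀ j → s j ≤ f j
      s≤f j with lookup O j
      ... | true  = clamp-mono-≤ (proj₁ (start<finish (I j)))
      ... | false = ≤-refl

      f≤b : ∀ j → f j ≤ b
      f≤b j with lookup O j
      ... | true  = clamp≤b _
      ... | false = a≤b

      separated : ∀ {j k} → j ≢ k → f j ≤ s k ⊎ f k ≤ s j
      separated {j} {k} j≢k with lookup O j in j∈O | lookup O k in k∈O
      ... | true  | true  = Sum.map clamp-mono-≤ clamp-mono-≤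
        (¬conflict⇒separated (I j) (I k) (disjoint (lookup⇒[]= j O j∈O) (lookup⇒[]= k O k∈O) j≢k))
      ... | true  | false = inj₂ (a≤clamp _)
      ... | false | true  = inj₁ (a≤clamp _)
      ... | false | false = inj₁ ≤-refl

      pointwise : ∀ j → (if lookup O j then sharedWeight i j else 0#) ≤ f j - s j
      pointwise j with lookup O j
      ... | false = x≤y⇒0≤y-x ≤-refl
      ... | true  = if-does-≤ (conflict? (I j) (I i))
        (λ conflict → let sⱼ≤q , p≤fⱼ = conflict⇒start≤finish (I j) (I i) conflict
                      in ⊓-clamp-≤ a≤b 0≤w p≤q sⱼ≤q p≤fⱼ)
        (x≤y⇒0≤y-x (clamp-mono-≤ (proj₁ (start<finish (I j)))))

-- Effect of one acceptance on weights.

module RevokeProportionalProperties {c ℓ₁ ℓ₂} (F : OrderedField c ℓ₁ ℓ₂) where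

  open OrderedField F hiding (zero)
  open IntervalSelection F
  open OrderedFieldProperties F
  open ScheduleProperties F
  open PosetReasoning (DecTotalOrder.poset decTotalOrder) hiding (start)
  open Sums +-commutativeMonoid using (sum; sum-cong-≋; ∑-distrib-+; sum-replicate-zero)

  module _ (ƛ : Carrier) {n} (I : Arrivals n) (Prd : Predictions n) where

    open RevokeProportional ƛ I Prd
    open DecMembership (Fin._≟_ {n}) using () renaming (_∈_ to _∈ˡ_; _∉_ to _∉ˡ_; _∈?_ to _∈ˡ?_)

    private
      w : Fin n → Carrier
      w i = weight (I i)

      0≤w : ∀ i → 0# ≤ w i
      0≤w i = weight-nonneg (I i)

      conflicts : Fin n → Fin n → Bool
      conflicts i j = does (conflict? (I i) (I j))

    lookup-conflicting : ∀ S i j → lookup (conflicting S i) j ≡ lookup S j ∧ conflicts i j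
    lookup-conflicting S i j = ≡.trans (lookup-∩ S (tabulate (conflicts i)) j)
      (≡.cong (lookup S j ∧_) (lookup∘tabulate (conflicts i) j))

    lookup-accept : ∀ S i j → lookup (accept S i) j ≡
                    (lookup S j ∧ not (lookup S j ∧ conflicts i j)) ∨ lookup ⁅ i ⁆ j
    lookup-accept S i j = ≡.trans (lookup-∪ (S ─ conflicting S i) ⁅ i ⁆ j)
      (≡.cong (_∨ lookup ⁅ i ⁆ j) (≡.trans (lookup-─ S (conflicting S i) j)
        (≡.cong (λ b → lookup S j ∧ not b) (lookup-conflicting S i j))))

    conflicts-self : ∀ i → conflicts i i ≡ true
    conflicts-self i = dec-true (conflict? (I i) (I i))
      (start (I i) , (≤-refl , start<finish (I i)) , (≤-refl , start<finish (I i)))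

    conflictWeight-nonneg : ∀ S i → 0# ≤ conflictWeight S i
    conflictWeight-nonneg S i = sumOver-nonneg (conflicting S i) 0≤w

    -- The exchange identity of an acceptance, kept free of subtraction and checked index by index
    -- on the membership bits.
    totalWeight-accept : ∀ S i →
      totalWeight I (accept S i) + conflictWeight S i ≈ totalWeight I S + w i
    totalWeight-accept S i = begin-equality
      totalWeight I (accept S i) + conflictWeight S i
        ≈⟨ ∑-distrib-+ {n} _ _ ⟨
      sum (λ j → (if lookup (accept S i) j then w j else 0#) +
                 (if lookup (conflicting S i) j then w j else 0#))
        ≈⟨ sum-cong-≋ pointwise ⟩
      sum (λ j → (if lookup S j then w j else 0#) + (if lookup ⁅ i ⁆ j then w j else 0#))
        ≈⟨ ∑-distrib-+ {n} _ _ ⟩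
      totalWeight I S + totalWeight I ⁅ i ⁆
        ≈⟨ +-congˡ (sumOver-⁅⁆ i w) ⟩
      totalWeight I S + w i
        ∎
      where
      -- The premise says that `i` conflicts with itself: an `i` already in `S` would be discarded
      -- before it is added, so that both sides count it twice.
      exchange : ∀ a b e x → (e ≡ true → b ≡ true) →
        (if (a ∧ not (a ∧ b)) ∨ e then x else 0#) + (if a ∧ b then x else 0#) ≈
        (if a then x else 0#) + (if e then x else 0#)
      exchange true  true  true  x _   = refl
      exchange true  true  false x _   = +-comm 0# x
      exchange true  false true  x e⇒b = contradiction (e⇒b ≡.refl) λ ()
      exchange true  false false x _   = refl
      exchange false b     true  x _   = +-comm x 0#
      exchange false b     false x _   = refl

      pointwise : ∀ j →
        (if lookup (accept S i) j then w j else 0#) +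
        (if lookup (conflicting S i) j then w j else 0#) ≈
        (if lookup S j then w j else 0#) + (if lookup ⁅ i ⁆ j then w j else 0#)
      pointwise j rewrite lookup-accept S i j | lookup-conflicting S i j =
        exchange (lookup S j) (conflicts i j) (lookup ⁅ i ⁆ j) (w j) λ j∈⁅i⁆ →
          ≡.subst (λ k → conflicts i k ≡ true)
            (≡.sym (x∈⁅y⁆⇒x≡y i (lookup⇒[]= j ⁅ i ⁆ j∈⁅i⁆))) (conflicts-self i)

    -- Only `i` can join the conflicts of `j`; the intervals discarded for `i` can only leave them,
    -- hence an inequality.
    conflictWeight-accept : ∀ S i j →
      conflictWeight (accept S i) j ≤ conflictWeight S j + (if conflicts j i then w i else 0#)
    conflictWeight-accept S i j = begin
      conflictWeight (accept S i) j
        ≤⟨ sum-mono-≤ pointwise ⟩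
      sum (λ k → (if lookup (conflicting S j) k then w k else 0#) +
                 (if lookup ⁅ i ⁆ k then (if conflicts j k then w k else 0#) else 0#))
        ≈⟨ ∑-distrib-+ {n} _ _ ⟩
      conflictWeight S j + sumOver ⁅ i ⁆ (λ k → if conflicts j k then w k else 0#)
        ≈⟨ +-congˡ (sumOver-⁅⁆ i _) ⟩
      conflictWeight S j + (if conflicts j i then w i else 0#)
        ∎
      where
      bound : ∀ a b d e {x} → 0# ≤ x →
        (if ((a ∧ not b) ∨ e) ∧ d then x else 0#) ≤
        (if a ∧ d then x else 0#) + (if e then (if d then x else 0#) else 0#)
      bound true  true  d true  0≤x = x≤x+y _ (if-nonneg d 0≤x)
      bound true  true  d false 0≤x = +-nonneg (if-nonneg d 0≤x) ≤-refl
      bound true  false d true  0≤x = x≤x+y _ (if-nonneg d 0≤x)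
      bound true  false d false 0≤x = x≤x+y _ ≤-refl
      bound false _     d true  0≤x = ≤-reflexive (sym (+-identityˡ _))
      bound false _     d false 0≤x = ≤-reflexive (sym (+-identityˡ 0#))

      pointwise : ∀ k →
        (if lookup (conflicting (accept S i) j) k then w k else 0#) ≤
        (if lookup (conflicting S j) k then w k else 0#) +
        (if lookup ⁅ i ⁆ k then (if conflicts j k then w k else 0#) else 0#)
      pointwise k rewrite lookup-conflicting (accept S i) j k
                        | lookup-conflicting S j k
                        | lookup-accept S i k =
        bound (lookup S k) (lookup S k ∧ conflicts i k) (conflicts j k) (lookup ⁅ i ⁆ k) (0≤w k)

    -- The potential and its changes.

    module _ {O} (disjoint : PairwiseDisjoint I O) (accurate : Accurate Prd O) where

      -- What the current solution S has to account for on behalf of j when the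
      -- intervals in the list is have yet to arrive.
      credit : List (Fin n) → Subset n → Fin n → Carrier
      credit is S j = if does (j ∈ˡ? is) then w j ⊓ conflictWeight S j else w j

      potential : List (Fin n) → Subset n → Carrier
      potential is S = sumOver O (credit is S)

      credit-arrived : ∀ is S {j} → j ∉ˡ is → credit is S j ≡ w j
      credit-arrived is S {j} j∉is =
        ≡.cong (λ b → if b then w j ⊓ conflictWeight S j else w j) (dec-false (j ∈ˡ? is) j∉is)

      credit-pending : ∀ is S {j} → j ∈ˡ is → credit is S j ≡ w j ⊓ conflictWeight S j
      credit-pending is S {j} j∈is =
        ≡.cong (λ b → if b then w j ⊓ conflictWeight S j else w j) (dec-true (j ∈ˡ? is) j∈is)

      credit-∷ : ∀ is S {i j} → j ≢ i → credit (i ∷ is) S j ≡ credit is S j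
      credit-∷ is S {i} {j} j≢i =
        -- `j ∈ˡ? (i ∷ is)` computes to this disjunction, whose first part is false for `j ≢ i`.
        ≡.cong (λ b → if b ∨ does (j ∈ˡ? is) then w j ⊓ conflictWeight S j else w j)
               (dec-false (j Fin.≟ i) j≢i)

      -- Once `j` has arrived its credit is constant. Before that, its conflict weight grows by at
      -- most `w i`, and only if the two meet; `⊓-subadditive` passes this through the cap.
      credit-accept : ∀ is S i j → credit is (accept S i) j ≤ credit is S j + sharedWeight I i j
      credit-accept is S i j with does (j ∈ˡ? is)
      ... | false = x≤x+y (w j) (sharedWeight-nonneg I i j)
      ... | true  = begin
        w j ⊓ conflictWeight (accept S i) j
          ≤⟨ ⊓-subadditive (0≤w j) (conflictWeight-nonneg S j) (if-nonneg (conflicts j i) (0≤w i))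
                           (conflictWeight-accept S i j) ⟩
        w j ⊓ conflictWeight S j + w j ⊓ (if conflicts j i then w i else 0#)
          ≤⟨ +-monoʳ-≤ _ (⊓-if (conflicts j i)) ⟩
        w j ⊓ conflictWeight S j + sharedWeight I i j
          ∎
        where
        ⊓-if : ∀ b → w j ⊓ (if b then w i else 0#) ≤ (if b then w j ⊓ w i else 0#)
        ⊓-if true  = ≤-refl
        ⊓-if false = x⊓y≤y (w j) 0#

      -- Every `j` in `O` differs from `i`, so none passes from pending to arrived; all that is
      -- added is the shared weights, at most `3# * w i` together.
      potential-accept-∉ : ∀ is S {i} → i ∉ O →
        potential is (accept S i) ≤ potential (i ∷ is) S + 3# * w i
      potential-accept-∉ is S {i} i∉O = begin
        potential is (accept S i)
          ≤⟨ sumOver-mono-≤ O pointwise ⟩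
        sumOver O (λ j → credit (i ∷ is) S j + sharedWeight I i j)
          ≈⟨ sumOver-distrib-+ O (credit (i ∷ is) S) (sharedWeight I i) ⟩
        potential (i ∷ is) S + sumOver O (sharedWeight I i)
          ≤⟨ +-monoʳ-≤ _ (sharedWeight-total I disjoint i) ⟩
        potential (i ∷ is) S + 3# * w i
          ∎
        where
        pointwise : ∀ {j} → j ∈ O →
          credit is (accept S i) j ≤ credit (i ∷ is) S j + sharedWeight I i j
        pointwise {j} j∈O = begin
          credit is (accept S i) j
            ≤⟨ credit-accept is S i j ⟩
          credit is S j + sharedWeight I i j
            ≡⟨ ≡.cong (_+ sharedWeight I i j)
                 (credit-∷ is S λ j≡i → i∉O (≡.subst (_∈ O) j≡i j∈O)) ⟨
          credit (i ∷ is) S j + sharedWeight I i j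
            ∎

      -- The other intervals of `O` are disjoint from `i`, so accepting `i` does not raise their
      -- credits. Only `i` itself gains, its credit going from the capped value to the full `w i`.
      potential-accept-∈ : ∀ is S {i} → i ∈ O → i ∉ˡ is →
        potential is (accept S i) ≤ potential (i ∷ is) S + (w i - w i ⊓ conflictWeight S i)
      potential-accept-∈ is S {i} i∈O i∉is = begin
        potential is (accept S i)
          ≤⟨ sumOver-mono-≤ O pointwise ⟩
        sumOver O (λ j → credit (i ∷ is) S j + δ j)
          ≈⟨ sumOver-distrib-+ O (credit (i ∷ is) S) δ ⟩
        potential (i ∷ is) S + sumOver O δ
          ≤⟨ +-monoʳ-≤ _ (sumOver≤sum O (λ j → if-nonneg (lookup ⁅ i ⁆ j) 0≤d)) ⟩
        potential (i ∷ is) S + sum δ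
          ≈⟨ +-congˡ (sumOver-⁅⁆ i (λ _ → d)) ⟩
        potential (i ∷ is) S + d
          ∎
        where
        d : Carrier
        d = w i - w i ⊓ conflictWeight S i

        δ : Fin n → Carrier
        -- All of the gain sits at `i`, so its sum over `O` is at most its full sum, which is `d`.
        δ j = if lookup ⁅ i ⁆ j then d else 0#

        0≤d : 0# ≤ d
        0≤d = x≤y⇒0≤y-x (x⊓y≤x (w i) (conflictWeight S i))

        pointwise : ∀ {j} → j ∈ O → credit is (accept S i) j ≤ credit (i ∷ is) S j + δ j
        pointwise {j} j∈O = bound (j Fin.≟ i)
          where
          bound : Dec (j ≡ i) → credit is (accept S i) j ≤ credit (i ∷ is) S j + δ j
          bound (yes ≡.refl) = begin
            credit is (accept S i) i
              ≡⟨ credit-arrived is (accept S i) i∉is ⟩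
            w i
              ≈⟨ x+[y-x]≈y (w i ⊓ conflictWeight S i) (w i) ⟨
            w i ⊓ conflictWeight S i + d
              ≡⟨ ≡.cong₂ _+_ (credit-pending (i ∷ is) S (here ≡.refl))
                   (≡.cong (λ b → if b then d else 0#) ([]=⇒lookup (x∈⁅x⁆ i))) ⟨
            credit (i ∷ is) S i + δ i
              ∎
          bound (no j≢i) = begin
            credit is (accept S i) j
              ≤⟨ credit-accept is S i j ⟩
            credit is S j + sharedWeight I i j
              ≡⟨ ≡.cong₂ _+_ (≡.sym (credit-∷ is S j≢i))
                   (sharedWeight-disjoint I {i} {j} (disjoint j∈O i∈O j≢i)) ⟩
            credit (i ∷ is) S j + 0#
              ≤⟨ +-monoʳ-≤ _ (if-nonneg (lookup ⁅ i ⁆ j) 0≤d) ⟩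
            credit (i ∷ is) S j + δ j
              ∎

      -- `S` is unchanged, so only the credit of `i` can move, from the capped value to `w i`;
      -- `covered` makes the two equal.
      potential-reject : ∀ is S {i} → i ∉ˡ is → (i ∈ O → w i ≤ conflictWeight S i) →
        potential is S ≤ potential (i ∷ is) S
      potential-reject is S {i} i∉is covered = sumOver-mono-≤ O pointwise
        where
        pointwise : ∀ {j} → j ∈ O → credit is S j ≤ credit (i ∷ is) S j
        pointwise {j} j∈O = bound (j Fin.≟ i)
          where
          bound : Dec (j ≡ i) → credit is S j ≤ credit (i ∷ is) S j
          bound (yes ≡.refl) = begin
            credit is S i                 ≡⟨ credit-arrived is S i∉is ⟩
            w i                           ≤⟨ ⊓-glb ≤-refl (covered j∈O) ⟩
            w i ⊓ conflictWeight S i      ≡⟨ credit-pending (i ∷ is) S (here ≡.refl) ⟨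
            credit (i ∷ is) S i           ∎
          bound (no j≢i) = ≤-reflexive (reflexive (≡.sym (credit-∷ is S j≢i)))

      -- By accuracy `i` is predicted and no other predicted interval conflicts with it, so of the
      -- three conditions of the predictions rule only the comparison of weights can fail.
      rejected-covered : ∀ S {i} → i ∈ O → i ∉ S → ¬ PredictionsRule S i → w i ≤ conflictWeight S i
      rejected-covered S {i} i∈O i∉S ¬rule with total (w i) (conflictWeight S i)
      ... | inj₁ w≤c = w≤c
      ... | inj₂ c≤w = contradiction
        (Equivalence.from (accurate i) i∈O , c≤w , unpredicted) ¬rule
        where
        unpredicted : ¬ ∃ λ j → j ∈ conflicting S i × Prd j ≡ true
        -- Since `i` is predicted and meets itself, the case `j ≡ i` has to be ruled out by `i ∉ S`;
        -- any other predicted `j` is in `O` and disjoint from `i`.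
        unpredicted (j , j∈C , predicted) with x∈p∩q⁻ S (tabulate (conflicts i)) j∈C | j Fin.≟ i
        ... | j∈S , _   | yes ≡.refl = i∉S j∈S
        ... | j∈S , j∈C | no j≢i = contradiction
          (≡.trans (≡.sym ([]=⇒lookup j∈C)) (≡.trans (lookup∘tabulate (conflicts i) j)
            (dec-false (conflict? (I i) (I j))
              (disjoint i∈O (Equivalence.to (accurate j) predicted) (j≢i ∘ ≡.sym)))))
          λ ()

      -- The invariant along the run.

      module _ {γ}
        (γ-main : ∀ {x y} → ƛ * x ≤ y → 3# * y + γ * x ≤ γ * y)
        (γ-predictions : ∀ {x y} → x ≤ y → (y - x) + γ * x ≤ γ * y)
        where

        -- Besides the bound, no pending interval is in the solution, which `rejected-covered`
        -- relies on when one of them is rejected.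
        Invariant : List (Fin n) → Subset n → Set _
        Invariant is S = potential is S ≤ γ * totalWeight I S × (∀ {i} → i ∈ˡ is → i ∉ S)

        -- Here `d` bounds the rise of the potential, and `charge` says that `γ` times the net gain
        -- of the solution pays for it. Adding `γ * conflictWeight S i` to both sides makes
        -- `totalWeight-accept` applicable without subtraction.
        potential-accept : ∀ is S {i} d →
          potential is (accept S i) ≤ potential (i ∷ is) S + d →
          d + γ * conflictWeight S i ≤ γ * w i →
          potential (i ∷ is) S ≤ γ * totalWeight I S →
          potential is (accept S i) ≤ γ * totalWeight I (accept S i)
        potential-accept is S {i} d increase charge bounded =
          +-cancelʳ-≤ (γ * conflictWeight S i) (begin
            potential is (accept S i) + γ * conflictWeight S i
              ≤⟨ +-monoˡ-≤ _ increase ⟩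
            (potential (i ∷ is) S + d) + γ * conflictWeight S i
              ≈⟨ +-assoc _ _ _ ⟩
            potential (i ∷ is) S + (d + γ * conflictWeight S i)
              ≤⟨ +-mono-≤ bounded charge ⟩
            γ * totalWeight I S + γ * w i
              ≈⟨ distribˡ γ _ _ ⟨
            γ * (totalWeight I S + w i)
              ≈⟨ *-congˡ (totalWeight-accept S i) ⟨
            γ * (totalWeight I (accept S i) + conflictWeight S i)
              ≈⟨ distribˡ γ _ _ ⟩
            γ * totalWeight I (accept S i) + γ * conflictWeight S i
              ∎)

        accept-fresh : ∀ {is S i} → i ∉ˡ is → (∀ {j} → j ∈ˡ i ∷ is → j ∉ S) →
                       ∀ {j} → j ∈ˡ is → j ∉ accept S i
        accept-fresh {is} {S} {i} i∉is fresh {j} j∈is j∈accept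
          with x∈p∪q⁻ (S ─ conflicting S i) ⁅ i ⁆ j∈accept
        ... | inj₁ j∈S─C = fresh (there j∈is) (p─q⊆p S (conflicting S i) j∈S─C)
        ... | inj₂ j∈⁅i⁆ = i∉is (≡.subst (_∈ˡ is) (x∈⁅y⁆⇒x≡y i j∈⁅i⁆) j∈is)

        step-invariant : ∀ {is S i} → i ∉ˡ is → Invariant (i ∷ is) S → Invariant is (step S i)
        step-invariant {is} {S} {i} i∉is (bounded , fresh)
          with mainRule? S i | predictionsRule? S i
        ... | no _ | no ¬predictions =
          ≤-trans (potential-reject is S i∉is λ i∈O →
            rejected-covered S i∈O (fresh (here ≡.refl)) ¬predictions) bounded
          , fresh ∘ there
        ... | no _ | yes (predicted , c≤w , _) =
          potential-accept is S _
            (potential-accept-∈ is S (Equivalence.to (accurate i) predicted) i∉is)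
            -- The rule gives `c≤w`, so the capped credit is the conflict weight itself.
            (≤-respˡ-≈ (+-congʳ (+-congˡ (-‿cong (sym (x≤y⇒y⊓x≈x c≤w))))) (γ-predictions c≤w))
            bounded
          , accept-fresh i∉is fresh
        ... | yes main | _ = potential-accept is S _ increase (γ-main main) bounded
                             , accept-fresh i∉is fresh
          where
          increase : potential is (accept S i) ≤ potential (i ∷ is) S + 3# * w i
          increase with i ∈? O
          ... | no  i∉O = potential-accept-∉ is S i∉O
          -- For `i` in `O` the rise is at most `w i`, within the allowance `3# * w i`, so one
          -- charge serves both cases.
          ... | yes i∈O = ≤-trans (potential-accept-∈ is S i∈O i∉is) (+-monoʳ-≤ _ (≤-trans
            (x-y≤x (w i) (⊓-glb (0≤w i) (conflictWeight-nonneg S i)))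
            (x≤3x (0≤w i))))

        foldl-invariant : ∀ {is S} → Unique is → Invariant is S → Invariant [] (foldl step S is)
        foldl-invariant []              invariant = invariant
        foldl-invariant (i∉is ∷ unique) invariant =
          foldl-invariant unique (step-invariant (All¬⇒¬Any i∉is) invariant)

        -- Everything is pending and the empty solution conflicts with nothing, so each credit is
        -- capped at zero.
        initial-invariant : Invariant (allFin n) ⊥
        initial-invariant = (begin
          potential (allFin n) ⊥     ≤⟨ sumOver-mono-≤ O (λ {j} _ → credit≤0 j) ⟩
          sumOver O (λ _ → 0#)       ≤⟨ sumOver≤sum O (λ _ → ≤-refl) ⟩
          sum {n} (λ _ → 0#)         ≈⟨ sum-replicate-zero n ⟩
          0#                         ≈⟨ zeroʳ γ ⟨
          γ * 0#                     ≈⟨ *-congˡ (sumOver-⊥ w) ⟨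
          γ * totalWeight I ⊥        ∎) , λ _ → ∉⊥
          where
          credit≤0 : ∀ j → credit (allFin n) ⊥ j ≤ 0#
          credit≤0 j rewrite credit-pending (allFin n) ⊥ (∈-allFin j) = begin
            w j ⊓ conflictWeight ⊥ j     ≤⟨ x⊓y≤y (w j) (conflictWeight ⊥ j) ⟩
            conflictWeight ⊥ j           ≡⟨ ≡.cong (totalWeight I) (∩-zeroˡ (tabulate (conflicts j))) ⟩
            totalWeight I ⊥              ≈⟨ sumOver-⊥ w ⟩
            0#                           ∎

        -- With nothing pending, every credit is a full weight, so the potential for the empty list
        -- computes to `totalWeight I O`.
        solution-bound : totalWeight I O ≤ γ * totalWeight I solution
        solution-bound = proj₁ (foldl-invariant (allFin⁺ n) initial-invariant)

-- The constant and the competitive ratio.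

module _ {c ℓ₁ ℓ₂} (F : OrderedField c ℓ₁ ℓ₂) where

  open OrderedField F hiding (zero)
  open IntervalSelection F
  open OrderedFieldProperties F
  open ScheduleProperties F
  open RevokeProportionalProperties F
  open PosetReasoning (DecTotalOrder.poset decTotalOrder) hiding (start)

  singleton-disjoint : ∀ {n} (I : Arrivals n) i → PairwiseDisjoint I ⁅ i ⁆
  singleton-disjoint I i j∈⁅i⁆ k∈⁅i⁆ j≢k _ =
    j≢k (≡.trans (x∈⁅y⁆⇒x≡y i j∈⁅i⁆) (≡.sym (x∈⁅y⁆⇒x≡y i k∈⁅i⁆)))

  -- The first arrival alone is a disjoint set, of positive weight.
  optimum-positive : ∀ {n} .{{_ : NonZero n}} (I : Arrivals n) {opt} → IsOPT I opt → 0# < opt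
  optimum-positive {suc n} I {opt} (_ , maximal) =
    <-≤-trans (x<y⇒0<y-x (start<finish (I zero))) (begin
    weight (I zero)              ≈⟨ sumOver-⁅⁆ zero (weight ∘ I) ⟨
    totalWeight I ⁅ zero ⁆       ≤⟨ maximal ⁅ zero ⁆ (singleton-disjoint I zero) ⟩
    opt                          ∎)

  module _ (ƛ : Carrier) (1<ƛ : 1# < ƛ) where

    γ : Carrier
    γ = (3# * ƛ) / (ƛ - 1#) ⟨ x<y⇒0<y-x 1<ƛ ⟩

    private
      0<ƛ-1 : 0# < ƛ - 1#
      0<ƛ-1 = x<y⇒0<y-x 1<ƛ

      -- The inverse hidden in the quotient: `γ` unfolds to `3# * ƛ * u`.
      u : Carrier
      u = proj₁ (invertible (proj₂ 0<ƛ-1 ∘ sym))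

      [ƛ-1]u≈1 : (ƛ - 1#) * u ≈ 1#
      [ƛ-1]u≈1 = proj₂ (proj₂ (invertible (proj₂ 0<ƛ-1 ∘ sym)))

      0≤u : 0# ≤ u
      0≤u = inverse-nonneg (proj₁ 0<ƛ-1) [ƛ-1]u≈1

      0≤3u : 0# ≤ 3# * u
      0≤3u = *-nonneg 0≤3 0≤u

    ƛu≈1+u : ƛ * u ≈ 1# + u
    ƛu≈1+u = begin-equality
      ƛ * u                        ≈⟨ *-congʳ ([x-y]+y≈x ƛ 1#) ⟨
      ((ƛ - 1#) + 1#) * u          ≈⟨ distribʳ u (ƛ - 1#) 1# ⟩
      (ƛ - 1#) * u + 1# * u        ≈⟨ +-cong [ƛ-1]u≈1 (*-identityˡ u) ⟩
      1# + u                       ∎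

    -- Since `3# * u` is `γ` divided by `ƛ`, this is the equation that determines `γ`: what the
    -- factor `ƛ` of the main rule leaves of `γ` is exactly 3.
    γ≈3+3u : γ ≈ 3# + 3# * u
    γ≈3+3u = begin-equality
      3# * ƛ * u                   ≈⟨ *-assoc 3# ƛ u ⟩
      3# * (ƛ * u)                 ≈⟨ *-congˡ ƛu≈1+u ⟩
      3# * (1# + u)                ≈⟨ distribˡ 3# 1# u ⟩
      3# * 1# + 3# * u             ≈⟨ +-congʳ (*-identityʳ 3#) ⟩
      3# + 3# * u                  ∎

    γx≈3u[ƛx] : ∀ x → γ * x ≈ 3# * u * (ƛ * x)
    γx≈3u[ƛx] x = begin-equality
      3# * ƛ * u * x               ≈⟨ *-congʳ (*-assoc 3# ƛ u) ⟩
      3# * (ƛ * u) * x             ≈⟨ *-congʳ (*-congˡ (*-comm ƛ u)) ⟩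
      3# * (u * ƛ) * x             ≈⟨ *-congʳ (*-assoc 3# u ƛ) ⟨
      3# * u * ƛ * x               ≈⟨ *-assoc (3# * u) ƛ x ⟩
      3# * u * (ƛ * x)             ∎

    -- The worst case is `ƛ * x ≈ y`, where both sides agree: of `γ ≈ 3# + 3# * u`, the first part
    -- pays for `3# * y` and the second for `γ * x`.
    γ-main : ∀ {x y} → ƛ * x ≤ y → 3# * y + γ * x ≤ γ * y
    γ-main {x} {y} ƛx≤y = begin
      3# * y + γ * x               ≈⟨ +-congˡ (γx≈3u[ƛx] x) ⟩
      3# * y + 3# * u * (ƛ * x)    ≤⟨ +-monoʳ-≤ (3# * y) (*-monoˡ-≤-nonneg 0≤3u ƛx≤y) ⟩
      3# * y + 3# * u * y          ≈⟨ distribʳ y 3# (3# * u) ⟨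
      (3# + 3# * u) * y            ≈⟨ *-congʳ γ≈3+3u ⟨
      γ * y                        ∎

    0≤γ : 0# ≤ γ
    0≤γ = ≤-respʳ-≈ (sym γ≈3+3u) (+-nonneg 0≤3 0≤3u)

    -- The gain `y - x` is nonnegative and `γ` is at least 3, more than the factor 1 to be paid.
    γ-predictions : ∀ {x y} → x ≤ y → (y - x) + γ * x ≤ γ * y
    γ-predictions {x} {y} x≤y = begin
      (y - x) + γ * x              ≤⟨ +-monoˡ-≤ (γ * x) (x≤3x 0≤y-x) ⟩
      3# * (y - x) + γ * x         ≤⟨ +-monoˡ-≤ (γ * x) (x≤x+y _ (*-nonneg 0≤3u 0≤y-x)) ⟩
      (3# * (y - x) + 3# * u * (y - x)) + γ * x  ≈⟨ +-congʳ (distribʳ (y - x) 3# (3# * u)) ⟨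
      (3# + 3# * u) * (y - x) + γ * x            ≈⟨ +-congʳ (*-congʳ γ≈3+3u) ⟨
      γ * (y - x) + γ * x          ≈⟨ distribˡ γ (y - x) x ⟨
      γ * ((y - x) + x)            ≈⟨ *-congˡ ([x-y]+y≈x y x) ⟩
      γ * y                        ∎
      where
      0≤y-x = x≤y⇒0≤y-x x≤y

    revokeProportional-consistent : Consistent γ (revokeProportional ƛ)
    revokeProportional-consistent I distinct Prd O (O-disjoint , _ , O-maximal) accurate opt
      isOPT@((S , S-disjoint , S≈opt) , _) = 0<alg , /-≤ 0<alg opt≤γ*alg
      where
      alg = totalWeight I (revokeProportional ƛ I Prd)

      opt≤γ*alg : opt ≤ γ * alg
      opt≤γ*alg = begin
        -- `opt` comes with its own witness `S`, so it is compared with `O` through the optimality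
        -- of `O`.
        opt                  ≈⟨ S≈opt ⟨
        totalWeight I S      ≤⟨ O-maximal S S-disjoint ⟩
        totalWeight I O      ≤⟨ solution-bound ƛ I Prd O-disjoint accurate γ-main γ-predictions ⟩
        γ * alg              ∎

      -- Were `alg ≤ 0#`, the bound just proved would give `opt ≤ 0#`, contrary to
      -- `optimum-positive`.
      0<alg : 0# < alg
      0<alg = ≰⇒> λ alg≤0 → <⇒≱ (optimum-positive I isOPT) (begin
        opt                  ≤⟨ opt≤γ*alg ⟩
        γ * alg              ≤⟨ *-monoˡ-≤-nonneg 0≤γ alg≤0 ⟩
        γ * 0#               ≈⟨ zeroʳ γ ⟩
        0#                   ∎)

theorem4p10 : ∀ {c ℓ₁ ℓ₂} (F : OrderedField c ℓ₁ ℓ₂) →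
    let open OrderedField F
        open IntervalSelection F
    in (ƛ : Carrier) (1<ƛ : 1# < ƛ) →
       Consistent (((1# + 1# + 1#) * ƛ) / (ƛ - 1#) ⟨ x<y⇒0<y-x 1<ƛ ⟩)
                  (revokeProportional ƛ)
theorem4p10 = revokeProportional-consistent
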